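{- For any integer $\Delta\ge 2$, there exists an isolate-free graph $G$ with maximum degree $\Delta(G)=\Delta$ such that its minimum degree $\delta(G)$ satisfies $\delta(G)<\left\lfloor\frac{\Delta(G)+2}{2}\right\rfloor$ and $$TC(G)\ge\delta(G)\,\bigl(\Delta(G)-\delta(G)+2\bigr).$$
   Context: All graphs are finite and simple (no loops or multiple edges). A graph is isolate-free if it has no vertex of degree $0$. A set $T\subseteq V$ of vertices of a graph $G(V,E)$ is a total dominating set if every vertex of $V$ is adjacent to at least one vertex of $T$. Two disjoint sets $A,B\subset V$ form a total coalition if neither $A$ nor $B$ is a total dominating set, but $A\cup B$ is. A total coalition partition of $G$ is a partition $\Psi=\{C_1,\dots,C_k\}$ of $V$ into non-empty classes such that for every $i$ there exists $j\neq i$ such that $C_i$ and $C_j$ form a total coalition. The total coalition number $TC(G)$ of an isolate-free graph $G$ is the maximum cardinality (number of classes) of a total coalition partition of $G$. -}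

module Defs where

open import Data.Fin using (Fin)
open import Data.Fin.Subset using (Subset; _∈_; _∩_; _∪_; ∣_∣; Empty; Nonempty)
open import Data.List using (List; map; allFin)
open import Data.List.Extrema.Nat using (max; min)
open import Data.Nat using (ℕ; _≤_)
open import Data.Product using (∃; _×_)
open import Data.Vec using (tabulate)
open import Level using (0ℓ)
open import Relation.Binary using (Rel; Decidable; Symmetric)
open import Relation.Binary.PropositionalEquality using (_≢_)
open import Relation.Nullary using (¬_; does)

-- Finite simple graphs, with vertex set Fin order.
record Graph : Set₁ where
  field
    order       : ℕ
    Adj         : Rel (Fin order) 0ℓ
    adj?        : Decidable Adj
    symmetric   : Symmetric Adj
    irreflexive : ∀ v → ¬ Adj v v

  Vertex : Set
  Vertex = Fin order

  neighbourhood : Vertex → Subset order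
  neighbourhood v = tabulate (λ u → does (adj? v u))

  degree : Vertex → ℕ
  degree v = ∣ neighbourhood v ∣

  degrees : List ℕ
  degrees = map degree (allFin order)

  maxDegree : ℕ
  maxDegree = max 0 degrees

  -- `order` is only the value returned for an empty list: every degree is
  -- smaller than it, so it never affects the minimum when a vertex exists.
  minDegree : ℕ
  minDegree = min order degrees

  IsolateFree : Set
  IsolateFree = ∀ v → degree v ≢ 0

  TotalDominating : Subset order → Set
  TotalDominating T = ∀ v → ∃ λ u → u ∈ T × Adj v u

  record TotalCoalition (A B : Subset order) : Set where
    field
      disjoint       : Empty (A ∩ B)
      ¬dominatingˡ   : ¬ TotalDominating A
      ¬dominatingʳ   : ¬ TotalDominating B
      dominating-∪   : TotalDominating (A ∪ B)

  record IsPartition {k : ℕ} (C : Fin k → Subset order) : Set where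
    field
      nonempty : ∀ i → Nonempty (C i)
      disjoint : ∀ {i j} → i ≢ j → Empty (C i ∩ C j)
      covers   : ∀ v → ∃ λ i → v ∈ C i

  record IsTotalCoalitionPartition {k : ℕ} (C : Fin k → Subset order) : Set where
    field
      isPartition : IsPartition C
      partner     : ∀ i → ∃ λ j → j ≢ i × TotalCoalition (C i) (C j)

  HasTotalCoalitionPartition : ℕ → Set
  HasTotalCoalitionPartition k =
    ∃ λ (C : Fin k → Subset order) → IsTotalCoalitionPartition C

  -- IsTC t says that TC(G) = t: the maximum is a predicate on its value, so
  -- that its being attained is part of any assertion about TC(G).
  record IsTC (t : ℕ) : Set where
    field
      attained : HasTotalCoalitionPartition t
      maximal  : ∀ {k} → HasTotalCoalitionPartition k → k ≤ t

{-# OPTIONS --safe #-}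

-- The star K_{1,Δ} has δ = 1, so it suffices to find Δ + 1 classes, which is its
-- number of vertices. The partition into singletons works: the centre and any
-- leaf together dominate every vertex, whereas the centre has no neighbour in
-- {centre} and a leaf has no neighbour among the leaves.
module Submission where

open import Defs
open import Data.Nat using (ℕ; _+_; _*_; _∸_; _≥_; _<_; _/_)
open import Data.Product using (∃; _×_)
open import Relation.Binary.PropositionalEquality using (_≡_)

open import Data.Bool using (true; false)
open import Data.Empty using (⊥)
open import Data.Fin using (Fin; zero; suc)
open import Data.Fin.Properties using (injective⇒≤; _≟_)
open import Data.Fin.Subset using (Subset; _∈_; _∩_; ⁅_⁆; ∣_∣; Empty)
open import Data.Fin.Subset.Properties
  using (∣⊤∣≡n; ∣⊥∣≡0; ∣p∣≤n; x∈⁅x⁆; x∈⁅y⁆⇒x≡y; x∈p∩q⁺; x∈p∩q⁻; x∈p∪q⁺; ∩-comm; ∪-comm)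
open import Data.List.Extrema.Nat using (max≈v⁺; min≈v⁺)
open import Data.List.Membership.Propositional.Properties using (∈-map⁺; ∈-allFin)
open import Data.List.Relation.Unary.All.Properties using (map⁺; tabulate⁺)
open import Data.Nat using (suc; s≤s; z≤n; _≤_)
open import Data.Nat.DivMod using (/-monoˡ-≤)
open import Data.Nat.Properties using (≤-refl; ≤-reflexive; +-comm; +-monoˡ-≤; *-identityˡ)
open import Data.Product using (_,_; proj₁; proj₂)
open import Data.Sum using (inj₁; inj₂)
open import Data.Unit using (⊤; tt)
open import Data.Vec using (tabulate; replicate)
open import Data.Vec.Properties using (tabulate-cong; tabulate∘lookup; lookup-replicate)
open import Function using (const; id)
open import Relation.Binary.PropositionalEquality
  using (_≢_; refl; sym; trans; cong; subst; subst₂)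
open import Relation.Nullary using (Dec; yes; no; ¬_; contradiction)

-- The sets `⊤` and `⊥` are defined by `replicate`, while neighbourhoods are tabulated. This bridges
-- the two, so that the sizes of `⊤` and `⊥` give the degrees in a star.
tabulate-const : ∀ {A : Set} n (x : A) → tabulate {n = n} (const x) ≡ replicate n x
tabulate-const n x =
  trans (tabulate-cong (λ i → sym (lookup-replicate i x))) (tabulate∘lookup (replicate n x))

x≢y⇒⁅x⁆∩⁅y⁆-Empty : ∀ {n} {x y : Fin n} → x ≢ y → Empty (⁅ x ⁆ ∩ ⁅ y ⁆)
x≢y⇒⁅x⁆∩⁅y⁆-Empty {x = x} {y} x≢y (z , z∈) with x∈p∩q⁻ ⁅ x ⁆ ⁅ y ⁆ z∈
... | z∈x , z∈y = x≢y (trans (sym (x∈⁅y⁆⇒x≡y x z∈x)) (x∈⁅y⁆⇒x≡y y z∈y))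

module _ (G : Graph) where
  open Graph G

  maxDegree≡degree : ∀ v → (∀ u → degree u ≤ degree v) → maxDegree ≡ degree v
  maxDegree≡degree v deg≤ =
    max≈v⁺ (∈-map⁺ degree (∈-allFin v)) (map⁺ (tabulate⁺ deg≤)) z≤n

  minDegree≡degree : ∀ v → (∀ u → degree v ≤ degree u) → minDegree ≡ degree v
  minDegree≡degree v ≤deg =
    -- The last argument discharges the default value `order` of the minimum: a neighbourhood is a
    -- set of vertices, so no degree exceeds `order`.
    min≈v⁺ (∈-map⁺ degree (∈-allFin v)) (map⁺ (tabulate⁺ ≤deg)) (∣p∣≤n (neighbourhood v))

  TotalCoalition-sym : ∀ {A B} → TotalCoalition A B → TotalCoalition B A
  TotalCoalition-sym {A} {B} AB = record
    { disjoint     = subst Empty (∩-comm A B) disjoint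
    ; ¬dominatingˡ = ¬dominatingʳ
    ; ¬dominatingʳ = ¬dominatingˡ
    ; dominating-∪ = subst TotalDominating (∪-comm A B) dominating-∪
    }
    where open TotalCoalition AB

  singletons-IsPartition : IsPartition (λ v → ⁅ v ⁆)
  singletons-IsPartition = record
    { nonempty = λ v → v , x∈⁅x⁆ v
    ; disjoint = x≢y⇒⁅x⁆∩⁅y⁆-Empty
    ; covers   = λ v → v , x∈⁅x⁆ v
    }

  -- Choosing one vertex in each class is injective, since a vertex chosen for two distinct classes
  -- would lie in their empty intersection. This gives the upper bound on the total coalition
  -- number.
  IsPartition⇒≤order : ∀ {k} {C : Fin k → Subset order} → IsPartition C → k ≤ order
  IsPartition⇒≤order {k} {C} P = injective⇒≤ {f = representative} representative-injective
    where
    open IsPartition P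

    representative : Fin k → Vertex
    representative i = proj₁ (nonempty i)

    representative-injective : ∀ {i j} → representative i ≡ representative j → i ≡ j
    representative-injective {i} {j} eq with i ≟ j
    ... | yes i≡j = i≡j
    ... | no  i≢j = contradiction
      (representative i ,
       x∈p∩q⁺ (proj₂ (nonempty i) , subst (_∈ C j) (sym eq) (proj₂ (nonempty j))))
      (disjoint i≢j)

star : ℕ → Graph
star n = record
  { order       = suc n
  ; Adj         = Adj
  ; adj?        = adj?
  ; symmetric   = λ {u} {v} → symmetric u v
  ; irreflexive = irreflexive
  }
  where
  Adj : Fin (suc n) → Fin (suc n) → Set
  Adj zero    zero    = ⊥
  Adj zero    (suc _) = ⊤
  Adj (suc _) zero    = ⊤
  Adj (suc _) (suc _) = ⊥

  adj? : ∀ u v → Dec (Adj u v)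
  adj? zero    zero    = no id
  adj? zero    (suc _) = yes tt
  adj? (suc _) zero    = yes tt
  adj? (suc _) (suc _) = no id

  symmetric : ∀ u v → Adj u v → Adj v u
  symmetric zero    (suc _) _ = tt
  symmetric (suc _) zero    _ = tt

  irreflexive : ∀ v → ¬ Adj v v
  irreflexive zero    = id
  irreflexive (suc _) = id

module _ (n : ℕ) where
  open Graph (star n)

  degree-centre : degree zero ≡ n
  degree-centre = trans (cong ∣_∣ (tabulate-const n true)) (∣⊤∣≡n n)

  degree-leaf : ∀ i → degree (suc i) ≡ 1
  -- The `suc` counts the centre, the first entry of the neighbourhood; the remaining entries, for
  -- the leaves, are all `false`.
  degree-leaf _ = cong suc (trans (cong ∣_∣ (tabulate-const n false)) (∣⊥∣≡0 n))

  centre-leaf-coalition : ∀ i → TotalCoalition ⁅ zero ⁆ ⁅ suc i ⁆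
  centre-leaf-coalition i = record
    { disjoint     = x≢y⇒⁅x⁆∩⁅y⁆-Empty {x = zero} {suc i} λ ()
    ; ¬dominatingˡ = ¬dominating-centre
    ; ¬dominatingʳ = ¬dominating-leaf
    ; dominating-∪ = λ
      { zero    → suc i , x∈p∪q⁺ {p = ⁅ zero ⁆} {⁅ suc i ⁆} (inj₂ (x∈⁅x⁆ (suc i))) , tt
      ; (suc _) → zero , x∈p∪q⁺ {p = ⁅ zero ⁆} {⁅ suc i ⁆} (inj₁ (x∈⁅x⁆ zero)) , tt
      }
    }
    where
    ¬dominating-centre : ¬ TotalDominating ⁅ zero ⁆
    ¬dominating-centre dom with dom zero
    -- Once `u` is identified with the centre, `adj` has type `Adj zero zero`, which reduces to `⊥`.
    ... | u , u∈ , adj with refl ← x∈⁅y⁆⇒x≡y zero u∈ = adj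

    ¬dominating-leaf : ¬ TotalDominating ⁅ suc i ⁆
    ¬dominating-leaf dom with dom (suc i)
    ... | u , u∈ , adj with refl ← x∈⁅y⁆⇒x≡y (suc i) u∈ = adj

module _ (m : ℕ) where
  -- At least one leaf is required: it keeps the centre from being isolated, attains the minimum
  -- degree and serves as the centre's partner.
  private n = suc m
  open Graph (star n)

  star-isolateFree : IsolateFree
  star-isolateFree zero    eq = contradiction (trans (sym (degree-centre n)) eq) λ ()
  star-isolateFree (suc i) eq = contradiction (trans (sym (degree-leaf n i)) eq) λ ()

  star-maxDegree : maxDegree ≡ n
  star-maxDegree = trans (maxDegree≡degree (star n) zero deg≤) (degree-centre n)
    where
    deg≤ : ∀ u → degree u ≤ degree zero
    deg≤ zero = ≤-refl
    deg≤ (suc i) rewrite degree-leaf n i | degree-centre n = s≤s z≤n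

  star-minDegree : minDegree ≡ 1
  star-minDegree = trans (minDegree≡degree (star n) (suc zero) ≤deg) (degree-leaf n zero)
    where
    ≤deg : ∀ u → degree (suc zero) ≤ degree u
    ≤deg zero    rewrite degree-leaf n zero | degree-centre n = s≤s z≤n
    ≤deg (suc i) = ≤-reflexive (trans (degree-leaf n zero) (sym (degree-leaf n i)))

  -- The singletons attain the bound that the number of vertices puts on any partition, so the value
  -- is exact.
  star-IsTC : IsTC (suc n)
  star-IsTC = record
    { attained = (λ v → ⁅ v ⁆) , record
      { isPartition = singletons-IsPartition (star n)
      ; partner     = λ
        { zero    → suc zero , (λ ()) , centre-leaf-coalition n zero
        ; (suc i) → zero , (λ ()) , TotalCoalition-sym (star n) (centre-leaf-coalition n i)
        }
      }
    ; maximal = λ (_ , P) →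
        IsPartition⇒≤order (star n) (IsTotalCoalitionPartition.isPartition P)
    }

theorem4p3 : (Δ : ℕ) → Δ ≥ 2 → ∃ λ (G : Graph) →
    Graph.IsolateFree G ×
    Graph.maxDegree G ≡ Δ ×
    Graph.minDegree G < (Graph.maxDegree G + 2) / 2 ×
    ∃ λ (TC : ℕ) → Graph.IsTC G TC ×
    TC ≥ Graph.minDegree G * (Graph.maxDegree G ∸ Graph.minDegree G + 2)
theorem4p3 (suc m) Δ≥2 = star (suc m) , star-isolateFree m , star-maxDegree m ,
  subst₂ (λ δ Δ → δ < (Δ + 2) / 2) (sym (star-minDegree m)) (sym (star-maxDegree m))
    -- With δ = 1 the goal is `2 ≤ (Δ + 2) / 2`. Its left side is the value of `(2 + 2) / 2`, so
    -- monotonicity in Δ ≥ 2 suffices.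
    (/-monoˡ-≤ 2 (+-monoˡ-≤ 2 Δ≥2)) ,
  suc (suc m) , star-IsTC m ,
  subst₂ (λ δ Δ → suc (suc m) ≥ δ * (Δ ∸ δ + 2)) (sym (star-minDegree m)) (sym (star-maxDegree m))
    -- For δ = 1 and Δ = `suc m` the bound reduces to `1 * (m + 2)`, which is exactly the order of
    -- the star.
    (≤-reflexive (trans (*-identityˡ (m + 2)) (+-comm m 2)))
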